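{- The following two properties of higher-order logic are equivalent. (Characterization property) For every formula $A$, $\vdash_c A^{Ku}\Leftrightarrow A$. (Kuroda-equivalence) For every constant or variable $t$ of type $\tau_1\to\dots\to\tau_n\to o$ and all terms $u_1,\dots,u_n$ of types $\tau_1,\dots,\tau_n$ respectively, $\vdash_c (t\,u_1\ldots u_n)_{Ku}\Leftrightarrow t\,u_1\ldots u_n$.
   Context: Syntax. Simple types are generated by: $\iota$ (individuals), $o$ (propositions), and $\tau \to \sigma$ for types $\tau,\sigma$. For each type $\tau$ there are a set $\mathcal{V}_\tau$ of variables (infinitely many, as usual) and a set $\mathcal{C}_\tau$ of constants; variables and constants are disjoint. Terms are simply typed: variables and constants of type $\tau$ are terms of type $\tau$; if $x\in\mathcal{V}_\tau$ and $t$ has type $\sigma$, then $\lambda x.t$ has type $\tau\to\sigma$; if $t$ has type $\tau\to\sigma$ and $u$ has type $\tau$, then $t\,u$ has type $\sigma$. Terms are taken up to renaming of bound variables; $t[x\leftarrow u]$ is capture-avoiding substitution; $\equiv_\beta$ is the congruence generated by $(\lambda x.t)u \hookrightarrow t[x\leftarrow u]$ (no $\eta$). Formulas are terms of type $o$. The constants include $\top,\bot$ of type $o$; $\neg$ of type $o\to o$; $\Rightarrow,\wedge,\vee$ of type $o\to o\to o$; and for every type $\tau$, $\forall_\tau,\exists_\tau$ of type $(\tau\to o)\to o$ and $=_\tau$ of type $\tau\to\tau\to o$ (written infix); there may be further constants. $\forall x.A$ and $\exists x.A$ abbreviate $\forall_\tau(\lambda x.A)$, $\exists_\tau(\lambda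 x.A)$; $A\Leftrightarrow B := (A\Rightarrow B)\wedge(B\Rightarrow A)$. $FV$ denotes free variables. A context is a finite sequence of formulas. Derivability. Intuitionistic logic has the usual natural deduction rules: introduction and elimination for $\Rightarrow,\wedge,\vee$; Not-I: from $\Gamma,A\vdash\bot$ infer $\Gamma\vdash\neg A$; Not-E: from $\Gamma\vdash\neg A$ and $\Gamma\vdash A$ infer $\Gamma\vdash\bot$; Bot-E: from $\Gamma\vdash\bot$ infer $\Gamma\vdash A$; Top-I: $\Gamma\vdash\top$; All-I: from $\Gamma\vdash P\,x$ with $x\notin FV(\Gamma,P)$ infer $\Gamma\vdash\forall P$; All-E: from $\Gamma\vdash\forall P$ infer $\Gamma\vdash P\,t$; Ex-I: from $\Gamma\vdash P\,t$ infer $\Gamma\vdash\exists P$; Ex-E: from $\Gamma\vdash\exists P$ and $\Gamma,P\,x\vdash A$ with $x\notin FV(\Gamma,P,A)$ infer $\Gamma\vdash A$; Ax: $\Gamma,A,\Delta\vdash A$; Conv: from $\Gamma\vdash A$ and $A\equiv_\beta B$ infer $\Gamma\vdash B$. Classical logic adds PEM: $\Gamma\vdash A\vee\neg A$. $\Gamma\vdash_c A$ denotes classical derivability (no rules for equality). Kuroda's translation. For a term $t$, $t_{Ku}$ is defined by: $x_{Ku}:=x$ for variables; $(\forall_\tau)_{Ku}:=\lambda p.\forall_\tau(\lambda x.\neg\neg(p\,x))$ for each type $\tau$; $c_{Ku}:=c$ for every other constant; $(\lambda x.t)_{Ku}:=\lambda x.t_{Ku}$; $(t\,u)_{Ku}:=t_{Ku}\,u_{Ku}$.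 For a formula $A$, $A^{Ku}:=\neg\neg A_{Ku}$. -}

module Defs where

open import Data.List.Base using (List; []; _∷_; foldr)
open import Data.List.Membership.Propositional using (_∈_; _∉_)
open import Data.List.Relation.Binary.Subset.Propositional using (_⊆_)
open import Data.List.Relation.Binary.Subset.Propositional.Properties using (∷⁺ʳ)
open import Data.List.Relation.Unary.All using (All; []; _∷_)
open import Data.List.Relation.Unary.Any using (here; there)
open import Data.Product.Base using (∃)
open import Data.Sum.Base using (_⊎_; [_,_]′)
open import Relation.Binary.Construct.Closure.Equivalence using (EqClosure)
open import Relation.Binary.PropositionalEquality using (refl)
open import Relation.Nullary.Negation using () renaming (¬_ to Not)

infixr 20 _⇾_ _⇛_

data Type : Set where
  ι o : Type
  _⇾_ : Type → Type → Type

-- (τ₁ ∷ … ∷ τₙ ∷ []) ⇛ σ  is  τ₁ ⇾ … ⇾ τₙ ⇾ σ.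
_⇛_ : List Type → Type → Type
τs ⇛ σ = foldr _⇾_ σ τs

record Signature : Set₁ where
  field
    -- Named variables; each 𝒱 τ is infinite in the sense that no finite list
    -- exhausts it.
    𝒱          : Type → Set
    𝒱-infinite : ∀ {τ} (xs : List (𝒱 τ)) → ∃ λ (x : 𝒱 τ) → x ∉ xs
    -- Constants other than the logical ones.
    𝒦          : Type → Set

module HOL (S : Signature) where
  open Signature S public

  data 𝒞 : Type → Set where
    ⊤ᶜ ⊥ᶜ       : 𝒞 o
    ¬ᶜ          : 𝒞 (o ⇾ o)
    ⇒ᶜ ∧ᶜ ∨ᶜ    : 𝒞 (o ⇾ o ⇾ o)
    ∀ᶜ ∃ᶜ       : ∀ τ → 𝒞 ((τ ⇾ o) ⇾ o)
    =ᶜ          : ∀ τ → 𝒞 (τ ⇾ τ ⇾ o)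
    other       : ∀ {τ} → 𝒦 τ → 𝒞 τ

  infixr 12 ƛ_
  infixl 18 _·_

  -- Terms up to renaming of bound variables: free variables are named, bound
  -- ones are well-scoped de Bruijn indices into the list Δ of the types of the
  -- enclosing binders.  Terms proper have Δ = [].
  data Term (Δ : List Type) : Type → Set where
    var : ∀ {τ} → 𝒱 τ → Term Δ τ
    bv  : ∀ {τ} → τ ∈ Δ → Term Δ τ
    con : ∀ {τ} → 𝒞 τ → Term Δ τ
    ƛ_  : ∀ {τ σ} → Term (τ ∷ Δ) σ → Term Δ (τ ⇾ σ)
    _·_ : ∀ {τ σ} → Term Δ (τ ⇾ σ) → Term Δ τ → Term Δ σ

  Formula : Set
  Formula = Term [] o

  rename : ∀ {Δ Δ′ τ} → Δ ⊆ Δ′ → Term Δ τ → Term Δ′ τ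
  rename ρ (var x) = var x
  rename ρ (bv i)  = bv (ρ i)
  rename ρ (con c) = con c
  rename ρ (ƛ t)   = ƛ rename (∷⁺ʳ _ ρ) t
  rename ρ (t · u) = rename ρ t · rename ρ u

  Sub : List Type → List Type → Set
  Sub Δ Δ′ = ∀ {τ} → τ ∈ Δ → Term Δ′ τ

  lift : ∀ {Δ Δ′ σ} → Sub Δ Δ′ → Sub (σ ∷ Δ) (σ ∷ Δ′)
  lift s (here refl) = bv (here refl)
  lift s (there i)   = rename there (s i)

  subst : ∀ {Δ Δ′ τ} → Sub Δ Δ′ → Term Δ τ → Term Δ′ τ
  subst s (var x) = var x
  subst s (bv i)  = s i
  subst s (con c) = con c
  subst s (ƛ t)   = ƛ subst (lift s) t
  subst s (t · u) = subst s t · subst s u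

  single : ∀ {Δ σ} → Term Δ σ → Sub (σ ∷ Δ) Δ
  single u (here refl) = u
  single u (there i)   = bv i

  _[_] : ∀ {Δ σ τ} → Term (σ ∷ Δ) τ → Term Δ σ → Term Δ τ
  t [ u ] = subst (single u) t

  infix 4 _↪β_ _≡β_ _∈FV_ _∉FV_ _⊢c_

  data _↪β_ {Δ : List Type} : ∀ {τ} → Term Δ τ → Term Δ τ → Set where
    β    : ∀ {τ σ} (t : Term (τ ∷ Δ) σ) (u : Term Δ τ) → (ƛ t) · u ↪β t [ u ]
    ξ    : ∀ {τ σ} {t t′ : Term (τ ∷ Δ) σ} → t ↪β t′ → ƛ t ↪β ƛ t′
    appˡ : ∀ {τ σ} {t t′ : Term Δ (τ ⇾ σ)} {u : Term Δ τ} →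
           t ↪β t′ → t · u ↪β t′ · u
    appʳ : ∀ {τ σ} {t : Term Δ (τ ⇾ σ)} {u u′ : Term Δ τ} →
           u ↪β u′ → t · u ↪β t · u′

  _≡β_ : ∀ {Δ τ} → Term Δ τ → Term Δ τ → Set
  _≡β_ = EqClosure _↪β_

  data _∈FV_ {σ : Type} (x : 𝒱 σ) {Δ : List Type} : ∀ {τ} → Term Δ τ → Set where
    var  : x ∈FV var x
    lam  : ∀ {τ ρ} {t : Term (τ ∷ Δ) ρ} → x ∈FV t → x ∈FV ƛ t
    appˡ : ∀ {τ ρ} {t : Term Δ (τ ⇾ ρ)} {u : Term Δ τ} → x ∈FV t → x ∈FV t · u
    appʳ : ∀ {τ ρ} {t : Term Δ (τ ⇾ ρ)} {u : Term Δ τ} → x ∈FV u → x ∈FV t · u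

  _∉FV_ : ∀ {σ Δ τ} → 𝒱 σ → Term Δ τ → Set
  x ∉FV t = Not (x ∈FV t)

  infix  17 ¬_
  infixr 16 _∧_
  infixr 15 _∨_
  infixr 14 _⇒_
  infix  13 _⇔_

  ⊤ ⊥ : ∀ {Δ} → Term Δ o
  ⊤ = con ⊤ᶜ
  ⊥ = con ⊥ᶜ

  ¬_ : ∀ {Δ} → Term Δ o → Term Δ o
  ¬ A = con ¬ᶜ · A

  _⇒_ _∧_ _∨_ _⇔_ : ∀ {Δ} → Term Δ o → Term Δ o → Term Δ o
  A ⇒ B = con ⇒ᶜ · A · B
  A ∧ B = con ∧ᶜ · A · B
  A ∨ B = con ∨ᶜ · A · B
  A ⇔ B = (A ⇒ B) ∧ (B ⇒ A)

  `∀ `∃ : ∀ {Δ τ} → Term Δ (τ ⇾ o) → Term Δ o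
  `∀ P = con (∀ᶜ _) · P
  `∃ P = con (∃ᶜ _) · P

  -- Contexts grow to the left: A ∷ Γ is the context written "Γ, A" on paper.
  data _⊢c_ (Γ : List Formula) : Formula → Set where
    ax   : ∀ {A} → A ∈ Γ → Γ ⊢c A
    conv : ∀ {A B} → Γ ⊢c A → A ≡β B → Γ ⊢c B
    ⊤I   : Γ ⊢c ⊤
    ⊥E   : ∀ {A} → Γ ⊢c ⊥ → Γ ⊢c A
    ¬I   : ∀ {A} → (A ∷ Γ) ⊢c ⊥ → Γ ⊢c ¬ A
    ¬E   : ∀ {A} → Γ ⊢c ¬ A → Γ ⊢c A → Γ ⊢c ⊥
    ⇒I   : ∀ {A B} → (A ∷ Γ) ⊢c B → Γ ⊢c A ⇒ B
    ⇒E   : ∀ {A B} → Γ ⊢c A ⇒ B → Γ ⊢c A → Γ ⊢c B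
    ∧I   : ∀ {A B} → Γ ⊢c A → Γ ⊢c B → Γ ⊢c A ∧ B
    ∧E₁  : ∀ {A B} → Γ ⊢c A ∧ B → Γ ⊢c A
    ∧E₂  : ∀ {A B} → Γ ⊢c A ∧ B → Γ ⊢c B
    ∨I₁  : ∀ {A B} → Γ ⊢c A → Γ ⊢c A ∨ B
    ∨I₂  : ∀ {A B} → Γ ⊢c B → Γ ⊢c A ∨ B
    ∨E   : ∀ {A B C} → Γ ⊢c A ∨ B → (A ∷ Γ) ⊢c C → (B ∷ Γ) ⊢c C → Γ ⊢c C
    ∀I   : ∀ {τ} {P : Term [] (τ ⇾ o)} (x : 𝒱 τ) →
           All (x ∉FV_) Γ → x ∉FV P →
           Γ ⊢c P · var x → Γ ⊢c `∀ P
    ∀E   : ∀ {τ} {P : Term [] (τ ⇾ o)} (t : Term [] τ) → Γ ⊢c `∀ P → Γ ⊢c P · t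
    ∃I   : ∀ {τ} {P : Term [] (τ ⇾ o)} (t : Term [] τ) → Γ ⊢c P · t → Γ ⊢c `∃ P
    ∃E   : ∀ {τ} {P : Term [] (τ ⇾ o)} {A} (x : 𝒱 τ) →
           All (x ∉FV_) Γ → x ∉FV P → x ∉FV A →
           Γ ⊢c `∃ P → (P · var x ∷ Γ) ⊢c A → Γ ⊢c A
    pem  : ∀ {A} → Γ ⊢c A ∨ ¬ A

  kuᶜ : ∀ {Δ τ} → 𝒞 τ → Term Δ τ
  kuᶜ (∀ᶜ τ) = ƛ `∀ (ƛ ¬ ¬ (bv (there (here refl)) · bv (here refl)))
  kuᶜ c      = con c

  ku : ∀ {Δ τ} → Term Δ τ → Term Δ τ
  ku (var x) = var x
  ku (bv i)  = bv i
  ku (con c) = kuᶜ c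
  ku (ƛ t)   = ƛ ku t
  ku (t · u) = ku t · ku u

  _ᴷᵘ : Formula → Formula
  A ᴷᵘ = ¬ ¬ ku A

  Atom : Type → Set
  Atom τ = 𝒞 τ ⊎ 𝒱 τ

  atom : ∀ {τ} → Atom τ → Term [] τ
  atom = [ con , var ]′

  _·*_ : ∀ {τs σ} → Term [] (τs ⇛ σ) → All (Term []) τs → Term [] σ
  t ·* []       = t
  t ·* (u ∷ us) = (t · u) ·* us

  CharacterizationProperty : Set
  CharacterizationProperty = ∀ (A : Formula) → [] ⊢c (A ᴷᵘ) ⇔ A

  KurodaEquivalence : Set
  KurodaEquivalence =
    ∀ (τs : List Type) (t : Atom (τs ⇛ o)) (us : All (Term []) τs) →
    [] ⊢c ku (atom t ·* us) ⇔ (atom t ·* us)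

{-# OPTIONS --safe #-}
-- Modulo classical double negation elimination, the characterization property
-- says ⊢ A_Ku ⇔ A for every formula A, and Kuroda-equivalence is its restriction
-- to the formulas whose head is an atom.  By a reducibility argument, every
-- formula is β-equivalent to one whose head is an atom; since t ↦ t_Ku commutes
-- with substitution, it preserves ≡β, so the restricted statement suffices.
module Submission where

open import Defs
open import Function.Bundles using (_⇔_; mk⇔)

open import Data.List.Base using (List; []; _∷_)
open import Data.List.Membership.Propositional using (_∈_)
open import Data.List.Relation.Binary.Subset.Propositional using (_⊆_)
open import Data.List.Relation.Binary.Subset.Propositional.Properties using (∷⁺ʳ)
open import Data.List.Relation.Unary.All using (All; []; _∷_)
open import Data.List.Relation.Unary.Any using (here; there)
open import Data.Product.Base using (∃; _×_; _,_)
open import Data.Sum.Base using (inj₁; inj₂)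
open import Relation.Binary.Construct.Closure.Equivalence
  using (return; symmetric; transitive; reflexive; isEquivalence; gmap; gfold)
open import Relation.Binary.PropositionalEquality
  using (_≡_; refl; sym; trans; cong; cong₂)

module _ (S : Signature) where
  open HOL S renaming (_⇔_ to _⇔′_)

  private variable
    Δ Δ′ Δ″ : List Type
    σ τ : Type

  -- Algebra of renamings and substitutions, up to pointwise equality.

  rename-cong : {ρ ρ′ : Δ ⊆ Δ′} → (∀ {τ} (i : τ ∈ Δ) → ρ i ≡ ρ′ i) →
                (t : Term Δ τ) → rename ρ t ≡ rename ρ′ t
  rename-cong eq (var x) = refl
  rename-cong eq (bv i)  = cong bv (eq i)
  rename-cong eq (con c) = refl
  rename-cong eq (ƛ t)   =
    cong ƛ_ (rename-cong (λ { (here refl) → refl ; (there i) → cong there (eq i) }) t)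
  rename-cong eq (t · u) = cong₂ _·_ (rename-cong eq t) (rename-cong eq u)

  rename-rename : (ρ′ : Δ′ ⊆ Δ″) (ρ : Δ ⊆ Δ′) (t : Term Δ τ) →
                  rename ρ′ (rename ρ t) ≡ rename (λ i → ρ′ (ρ i)) t
  rename-rename ρ′ ρ (var x) = refl
  rename-rename ρ′ ρ (bv i)  = refl
  rename-rename ρ′ ρ (con c) = refl
  rename-rename ρ′ ρ (ƛ t)   = cong ƛ_
    (trans (rename-rename (∷⁺ʳ _ ρ′) (∷⁺ʳ _ ρ) t)
           (rename-cong (λ { (here refl) → refl ; (there i) → refl }) t))
  rename-rename ρ′ ρ (t · u) = cong₂ _·_ (rename-rename ρ′ ρ t) (rename-rename ρ′ ρ u)

  subst-cong : {s s′ : Sub Δ Δ′} → (∀ {τ} (i : τ ∈ Δ) → s i ≡ s′ i) →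
               (t : Term Δ τ) → subst s t ≡ subst s′ t
  subst-cong eq (var x) = refl
  subst-cong eq (bv i)  = eq i
  subst-cong eq (con c) = refl
  subst-cong eq (ƛ t)   = cong ƛ_
    (subst-cong (λ { (here refl) → refl ; (there i) → cong (rename there) (eq i) }) t)
  subst-cong eq (t · u) = cong₂ _·_ (subst-cong eq t) (subst-cong eq u)

  subst-rename : (s : Sub Δ′ Δ″) (ρ : Δ ⊆ Δ′) (t : Term Δ τ) →
                 subst s (rename ρ t) ≡ subst (λ i → s (ρ i)) t
  subst-rename s ρ (var x) = refl
  subst-rename s ρ (bv i)  = refl
  subst-rename s ρ (con c) = refl
  subst-rename s ρ (ƛ t)   = cong ƛ_
    (trans (subst-rename (lift s) (∷⁺ʳ _ ρ) t)
           (subst-cong (λ { (here refl) → refl ; (there i) → refl }) t))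
  subst-rename s ρ (t · u) = cong₂ _·_ (subst-rename s ρ t) (subst-rename s ρ u)

  rename-subst : (ρ : Δ′ ⊆ Δ″) (s : Sub Δ Δ′) (t : Term Δ τ) →
                 rename ρ (subst s t) ≡ subst (λ i → rename ρ (s i)) t
  rename-subst ρ s (var x) = refl
  rename-subst ρ s (bv i)  = refl
  rename-subst ρ s (con c) = refl
  rename-subst ρ s (ƛ t)   = cong ƛ_
    (trans (rename-subst (∷⁺ʳ _ ρ) (lift s) t)
           (subst-cong (λ { (here refl) → refl
                          ; (there i) → trans (rename-rename (∷⁺ʳ _ ρ) there (s i))
                                              (sym (rename-rename there ρ (s i))) }) t))
  rename-subst ρ s (t · u) = cong₂ _·_ (rename-subst ρ s t) (rename-subst ρ s u)

  subst-subst : (s′ : Sub Δ′ Δ″) (s : Sub Δ Δ′) (t : Term Δ τ) →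
                subst s′ (subst s t) ≡ subst (λ i → subst s′ (s i)) t
  subst-subst s′ s (var x) = refl
  subst-subst s′ s (bv i)  = refl
  subst-subst s′ s (con c) = refl
  subst-subst s′ s (ƛ t)   = cong ƛ_
    (trans (subst-subst (lift s′) (lift s) t)
           (subst-cong (λ { (here refl) → refl
                          ; (there i) → trans (subst-rename (lift s′) there (s i))
                                              (sym (rename-subst there s′ (s i))) }) t))
  subst-subst s′ s (t · u) = cong₂ _·_ (subst-subst s′ s t) (subst-subst s′ s u)

  subst-bv : (t : Term Δ τ) → subst bv t ≡ t
  subst-bv (var x) = refl
  subst-bv (bv i)  = refl
  subst-bv (con c) = refl
  subst-bv (ƛ t)   = cong ƛ_
    (trans (subst-cong (λ { (here refl) → refl ; (there i) → refl }) t) (subst-bv t))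
  subst-bv (t · u) = cong₂ _·_ (subst-bv t) (subst-bv u)

  infixr 5 _▸_
  _▸_ : Term Δ′ σ → Sub Δ Δ′ → Sub (σ ∷ Δ) Δ′
  (u ▸ s) (here refl) = u
  (u ▸ s) (there i)   = s i

  -- Turns the contractum of a substituted abstraction into one simultaneous substitution. The
  -- weakening that `lift` applies to each `s i` is undone by `single u`.
  lift-single : (s : Sub Δ Δ′) (u : Term Δ′ σ) (t : Term (σ ∷ Δ) τ) →
                subst (lift s) t [ u ] ≡ subst (u ▸ s) t
  lift-single s u t = trans (subst-subst (single u) (lift s) t) (subst-cong pointwise t)
    where
    pointwise : ∀ {τ} (i : τ ∈ _ ∷ _) → lift s i [ u ] ≡ (u ▸ s) i
    pointwise (here refl) = refl
    pointwise (there i)   = trans (subst-rename (single u) there (s i)) (subst-bv (s i))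

  -- Conversion as a congruence.

  ≡⇒≡β : {t u : Term Δ τ} → t ≡ u → t ≡β u
  ≡⇒≡β refl = reflexive _↪β_

  ·-congˡ : {t t′ : Term Δ (σ ⇾ τ)} {u : Term Δ σ} → t ≡β t′ → t · u ≡β t′ · u
  ·-congˡ = gmap (_· _) appˡ

  ·-congʳ : {t : Term Δ (σ ⇾ τ)} {u u′ : Term Δ σ} → u ≡β u′ → t · u ≡β t · u′
  ·-congʳ = gmap (_ ·_) appʳ

  ·-cong : {t t′ : Term Δ (σ ⇾ τ)} {u u′ : Term Δ σ} → t ≡β t′ → u ≡β u′ → t · u ≡β t′ · u′
  ·-cong p q = transitive _↪β_ (·-congˡ p) (·-congʳ q)

  ⇔-cong : {A A′ B B′ : Term Δ o} → A ≡β A′ → B ≡β B′ → (A ⇔′ B) ≡β (A′ ⇔′ B′)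
  ⇔-cong p q = ·-cong (·-congʳ (·-cong (·-congʳ p) q)) (·-cong (·-congʳ q) p)

  -- Kuroda's translation under substitution and conversion.

  rename-kuᶜ : (ρ : Δ ⊆ Δ′) (c : 𝒞 τ) → rename ρ (kuᶜ c) ≡ kuᶜ c
  -- One clause per constant: `kuᶜ` ends in a catch-all and computes only on a known constructor.
  rename-kuᶜ ρ ⊤ᶜ        = refl
  rename-kuᶜ ρ ⊥ᶜ        = refl
  rename-kuᶜ ρ ¬ᶜ        = refl
  rename-kuᶜ ρ ⇒ᶜ        = refl
  rename-kuᶜ ρ ∧ᶜ        = refl
  rename-kuᶜ ρ ∨ᶜ        = refl
  rename-kuᶜ ρ (∀ᶜ τ)    = refl
  rename-kuᶜ ρ (∃ᶜ τ)    = refl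
  rename-kuᶜ ρ (=ᶜ τ)    = refl
  rename-kuᶜ ρ (other k) = refl

  subst-kuᶜ : (s : Sub Δ Δ′) (c : 𝒞 τ) → subst s (kuᶜ c) ≡ kuᶜ c
  subst-kuᶜ s ⊤ᶜ        = refl
  subst-kuᶜ s ⊥ᶜ        = refl
  subst-kuᶜ s ¬ᶜ        = refl
  subst-kuᶜ s ⇒ᶜ        = refl
  subst-kuᶜ s ∧ᶜ        = refl
  subst-kuᶜ s ∨ᶜ        = refl
  subst-kuᶜ s (∀ᶜ τ)    = refl
  subst-kuᶜ s (∃ᶜ τ)    = refl
  subst-kuᶜ s (=ᶜ τ)    = refl
  subst-kuᶜ s (other k) = refl

  ku-rename : (ρ : Δ ⊆ Δ′) (t : Term Δ τ) → ku (rename ρ t) ≡ rename ρ (ku t)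
  ku-rename ρ (var x) = refl
  ku-rename ρ (bv i)  = refl
  ku-rename ρ (con c) = sym (rename-kuᶜ ρ c)
  ku-rename ρ (ƛ t)   = cong ƛ_ (ku-rename (∷⁺ʳ _ ρ) t)
  ku-rename ρ (t · u) = cong₂ _·_ (ku-rename ρ t) (ku-rename ρ u)

  -- Translated constants contain no loose indices, so the substitution acts only at the indices of
  -- `t`, which `ku` leaves in place.
  ku-subst : (s : Sub Δ Δ′) (t : Term Δ τ) → ku (subst s t) ≡ subst (λ i → ku (s i)) (ku t)
  ku-subst s (var x) = refl
  ku-subst s (bv i)  = refl
  ku-subst s (con c) = sym (subst-kuᶜ (λ i → ku (s i)) c)
  ku-subst s (ƛ t)   = cong ƛ_
    (trans (ku-subst (lift s) t)
           (subst-cong (λ { (here refl) → refl ; (there i) → ku-rename there (s i) }) (ku t)))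
  ku-subst s (t · u) = cong₂ _·_ (ku-subst s t) (ku-subst s u)

  ku-↪β : {t u : Term Δ τ} → t ↪β u → ku t ≡β ku u
  ku-↪β (β t u)  = transitive _↪β_ (return (β (ku t) (ku u)))
    -- The translated redex is again a redex; its contractum is the translated one because `ku`
    -- sends `single u` to `single (ku u)`.
    (≡⇒≡β (sym (trans (ku-subst (single u) t)
      (subst-cong (λ { (here refl) → refl ; (there i) → refl }) (ku t)))))
  ku-↪β (ξ r)    = gmap ƛ_ ξ (ku-↪β r)
  ku-↪β (appˡ r) = ·-congˡ (ku-↪β r)
  ku-↪β (appʳ r) = ·-congʳ (ku-↪β r)

  ku-≡β : {t u : Term Δ τ} → t ≡β u → ku t ≡β ku u
  ku-≡β = gfold (isEquivalence _↪β_) ku ku-↪β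

  -- Reducibility and atom heads.

  data AtomHeaded : Term [] τ → Set where
    head : (a : Atom τ) → AtomHeaded (atom a)
    _·_  : {t : Term [] (σ ⇾ τ)} → AtomHeaded t → (u : Term [] σ) → AtomHeaded (t · u)

  HasAtomHead : Term [] τ → Set
  HasAtomHead t = ∃ λ u → t ≡β u × AtomHeaded u

  -- A Tait-style logical predicate. An atom head is demanded only at base types, since an
  -- abstraction need not have one.
  Red : (τ : Type) → Term [] τ → Set
  Red ι       t = HasAtomHead t
  Red o       t = HasAtomHead t
  Red (σ ⇾ τ) t = ∀ u → Red σ u → Red τ (t · u)

  Red-≡β : ∀ τ {t u : Term [] τ} → t ≡β u → Red τ u → Red τ t
  Red-≡β ι       p (v , q , h) = v , transitive _↪β_ p q , h
  Red-≡β o       p (v , q , h) = v , transitive _↪β_ p q , h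
  Red-≡β (σ ⇾ τ) p r u ru      = Red-≡β τ (·-congˡ p) (r u ru)

  -- Application preserves an atom head, so induction on the type descends to a base type.
  AtomHeaded⇒Red : ∀ τ {t : Term [] τ} → AtomHeaded t → Red τ t
  AtomHeaded⇒Red ι       h      = _ , reflexive _↪β_ , h
  AtomHeaded⇒Red o       h      = _ , reflexive _↪β_ , h
  AtomHeaded⇒Red (σ ⇾ τ) h u _ = AtomHeaded⇒Red τ (h · u)

  -- The fundamental lemma of the logical predicate. Named variables count as atoms, so only indices
  -- need reducible images.
  Red-subst : (s : Sub Δ []) → (∀ {τ} (i : τ ∈ Δ) → Red τ (s i)) →
              (t : Term Δ τ) → Red τ (subst s t)
  Red-subst s rs (var x) = AtomHeaded⇒Red _ (head (inj₂ x))
  Red-subst s rs (bv i)  = rs i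
  Red-subst s rs (con c) = AtomHeaded⇒Red _ (head (inj₁ c))
  Red-subst s rs (ƛ t) u ru =
    -- Contract the redex, then apply the induction hypothesis to the body with `u` for the new
    -- index.
    Red-≡β _ (transitive _↪β_ (return (β (subst (lift s) t) u)) (≡⇒≡β (lift-single s u t)))
      (Red-subst (u ▸ s) (λ { (here refl) → ru ; (there i) → rs i }) t)
  Red-subst s rs (t · u) = Red-subst s rs t (subst s u) (Red-subst s rs u)

  hasAtomHead : (A : Formula) → HasAtomHead A
  -- A formula has no loose indices, so the identity substitution `bv` is vacuously reducible.
  hasAtomHead A = Red-≡β o (≡⇒≡β (sym (subst-bv A))) (Red-subst bv (λ ()) A)

  -- `AtomHeaded` adds arguments at the outer end, while `_·*_` consumes them from the head
  -- outwards; the accumulator `us` collects the spine until the atom is reached.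
  ku-⇔-·* : KurodaEquivalence → (τs : List Type) {t : Term [] (τs ⇛ o)} → AtomHeaded t →
            (us : All (Term []) τs) → [] ⊢c ku (t ·* us) ⇔′ (t ·* us)
  ku-⇔-·* ke τs (head a) us = ke τs a us
  ku-⇔-·* ke τs (h · u)  us = ku-⇔-·* ke (_ ∷ τs) h (u ∷ us)

  ku-⇔ : KurodaEquivalence → (A : Formula) → [] ⊢c ku A ⇔′ A
  ku-⇔ ke A with B , p , h ← hasAtomHead A =
    conv (ku-⇔-·* ke [] h []) (symmetric _↪β_ (⇔-cong (ku-≡β p) p))

  -- Stated as derivable implications rather than as rules: a rule would have to
  -- weaken its premise, which the eigenvariable conditions make awkward.
  ¬¬-⇔ : ∀ {Γ A B} → Γ ⊢c (A ⇔′ B) ⇒ ((¬ ¬ A) ⇔′ B)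
  ¬¬-⇔ = ⇒I (∧I
    (⇒I (⇒E (∧E₁ (ax (there (here refl))))
            -- Double negation elimination: the case `¬ A` contradicts `¬ ¬ A`.
            (∨E pem (ax (here refl))
                    (⊥E (¬E (ax (there (here refl))) (ax (here refl)))))))
    (⇒I (¬I (¬E (ax (here refl))
                (⇒E (∧E₂ (ax (there (there (here refl))))) (ax (there (here refl))))))))

  ¬¬-⇔⁻¹ : ∀ {Γ A B} → Γ ⊢c ((¬ ¬ A) ⇔′ B) ⇒ (A ⇔′ B)
  ¬¬-⇔⁻¹ = ⇒I (∧I
    (⇒I (⇒E (∧E₁ (ax (there (here refl))))
            (¬I (¬E (ax (here refl)) (ax (there (here refl)))))))
    -- In the case `¬ A`, the hypothesis `B` yields the contradictory `¬ ¬ A`.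
    (⇒I (∨E pem (ax (here refl))
                (⊥E (¬E (⇒E (∧E₂ (ax (there (there (here refl))))) (ax (there (here refl))))
                        (ax (here refl)))))))

theorem3 : (S : Signature) → HOL.CharacterizationProperty S ⇔ HOL.KurodaEquivalence S
theorem3 S = mk⇔
  -- The instance of `cp` is the formula `atom t ·* us`.
  (λ cp τs t us → HOL.⇒E (¬¬-⇔⁻¹ S) (cp _))
  (λ ke A → HOL.⇒E (¬¬-⇔ S) (ku-⇔ S ke A))
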